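{- For any integer $n\geq 1$, $$\Phi(C_{2n})=\binom{n}{2} + \left\lfloor\frac{n}{2}\right\rfloor + 1.$$
   Context: $C_m$ denotes the cycle with vertices $0,1,\dots,m-1$ and edges $\{i,i+1 \bmod m\}$. For a connected graph $G$ with vertex set $V(G)$, a path system of $G$ is a set consisting of one chosen path in $G$ connecting $a$ and $b$ for each unordered pair $\{a,b\}$ of distinct vertices. A global packing of $(G,\mathcal{P})$ is a map $\omega:\mathcal{P}\to\{1,\dots,k\}$ such that $\omega(P)\neq\omega(P')$ whenever distinct paths $P,P'\in\mathcal{P}$ share at least one edge; $\Phi(G,\mathcal{P})$ is the minimum such $k$, and $\Phi(G)$ is the minimum of $\Phi(G,\mathcal{P})$ over all path systems $\mathcal{P}$ of $G$. -}

module Defs where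

open import Data.Nat using (ℕ; zero; suc; _≤_)
open import Data.Fin using (Fin; toℕ) renaming (_<_ to _<ᶠ_)
open import Data.List using (List; []; _∷_; head; last)
open import Data.List.Relation.Unary.Linked using (Linked)
open import Data.List.Relation.Unary.Unique.Propositional using (Unique)
open import Data.Maybe using (just)
open import Data.Product using (Σ; ∃; ∃-syntax; _×_; _,_)
open import Data.Sum using (_⊎_)
open import Relation.Binary.PropositionalEquality using (_≡_; _≢_)
open import Relation.Nullary using (¬_)

CycleStep : (m : ℕ) → Fin m → Fin m → Set
CycleStep m u v = (suc (toℕ u) ≡ toℕ v) ⊎ (suc (toℕ u) ≡ m × toℕ v ≡ 0)

CycleAdj : (m : ℕ) → Fin m → Fin m → Set
CycleAdj m u v = CycleStep m u v ⊎ CycleStep m v u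

record CyclePath (m : ℕ) (a b : Fin m) : Set where
  field
    verts    : List (Fin m)
    starts   : head verts ≡ just a
    ends     : last verts ≡ just b
    adjacent : Linked (CycleAdj m) verts
    distinct : Unique verts
open CyclePath public

data Consec {m : ℕ} : List (Fin m) → Fin m → Fin m → Set where
  here  : ∀ {x y xs} → Consec (x ∷ y ∷ xs) x y
  there : ∀ {x xs u v} → Consec xs u v → Consec (x ∷ xs) u v

UsesEdge : {m : ℕ} → List (Fin m) → Fin m → Fin m → Set
UsesEdge xs u v = Consec xs u v ⊎ Consec xs v u

ShareEdge : {m : ℕ} {a b c d : Fin m} → CyclePath m a b → CyclePath m c d → Set
ShareEdge {m} P Q = ∃[ u ] ∃[ v ] (UsesEdge (verts P) u v × UsesEdge (verts Q) u v)

-- A path system: one chosen path for every unordered pair {a,b} of distinct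
-- vertices; the pair is represented by its ordered version a < b.
PathSystem : ℕ → Set
PathSystem m = (a b : Fin m) → a <ᶠ b → CyclePath m a b

-- A global packing of (C_m, 𝒫) with colours {1,…,k} (represented as Fin k):
-- paths of distinct pairs sharing an edge get different colours.
-- (Distinct pairs give distinct paths, as their endpoint sets differ.)
IsGlobalPacking : {m : ℕ} (k : ℕ) → PathSystem m →
                  ((a b : Fin m) → a <ᶠ b → Fin k) → Set
IsGlobalPacking {m} k 𝒫 ω =
  (a b c d : Fin m) (p : a <ᶠ b) (q : c <ᶠ d) →
  ¬ (a ≡ c × b ≡ d) →
  ShareEdge (𝒫 a b p) (𝒫 c d q) →
  ω a b p ≢ ω c d q

Packable : ℕ → ℕ → Set
Packable m k = Σ (PathSystem m) λ 𝒫 →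
               Σ ((a b : Fin m) → a <ᶠ b → Fin k) λ ω → IsGlobalPacking k 𝒫 ω

Φ-Cycle-is : ℕ → ℕ → Set
Φ-Cycle-is m N = Packable m N × (∀ k → Packable m k → N ≤ k)

{-# OPTIONS --safe #-}
module Submission where

-- Lower bound.  A path between a and b contains one of the two arcs of the cycle between
-- them.  Let L(e) ≤ k be the number of these arcs through the edge e.  Opposite edges e, e + n
-- form a cut separating n² pairs, so L(e) + L(e + n) ≥ n².  If 2k ≤ n² then all loads equal k;
-- but the two edges at a vertex have loads differing by an odd number, as 2n − 1 arcs end there.
-- Hence 2k > n².
--
-- Upper bound.  For i < j < n the points i, j, i + n, j + n cut the cycle into four arcs, and
-- these C(n,2) classes contain every non-antipodal pair once.  For j odd, the class of {0, j}
-- gives up its two arcs meeting at 0 and receives the antipodal arc from j + n through 0 to j.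
-- The arcs given up and the antipodal arcs from an even j to j + n form a helix with gaps of one
-- edge, which winds ⌊n/2⌋ + 1 times around the cycle and is cut at 0 into that many classes.

open import Defs
open import Data.Bool using (Bool; true; false; not; if_then_else_; _∧_)
open import Data.Empty using (⊥)
open import Data.Fin using (Fin; zero; suc; toℕ; fromℕ<) renaming (_<_ to _<ᶠ_)
open import Data.Fin.Properties using (toℕ-injective; toℕ<n; toℕ-fromℕ<; fromℕ<-injective; all?; ¬∀⟶∃¬) renaming (_≟_ to _≟ᶠ_)
open import Data.List using (List; []; _∷_; head; last; applyUpTo)
open import Data.List.Relation.Unary.Linked using (Linked; _∷_)
import Data.List.Relation.Unary.Linked.Properties as Linked
import Data.List.Relation.Unary.Unique.Propositional.Properties as Unique
open import Data.Maybe using (just)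
open import Data.Nat
open import Data.Nat.Combinatorics using (_C_; nC1≡n; nCk+nC[k+1]≡[n+1]C[k+1])
open import Data.Nat.DivMod using (_mod_; m%n<n; m<n⇒m%n≡m; n%n≡0; [m+n]%n≡m%n; [m+kn]%n≡m%n; m≡m%n+[m/n]*n; /-monoˡ-≤; m*n/n≡m; m/n*n≤m)
open import Data.Nat.Properties
open import Data.Nat.Tactic.RingSolver using (solve-∀)
open import Data.Product as Product using (Σ; ∃-syntax; _×_; _,_; proj₁; proj₂)
open import Data.Product.Properties using (,-injective)
open import Data.Sum using (_⊎_; inj₁; inj₂; [_,_]′; swap)
open import Function using (_∘_; case_of_)
open import Relation.Binary.Definitions using (tri<; tri≈; tri>)
open import Relation.Binary.PropositionalEquality
open import Relation.Nullary using (¬_; Dec; yes; no; does; contradiction; ¬?)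
open import Relation.Nullary.Decidable using (dec-true; dec-false; _×-dec_; _⊎-dec_; _→-dec_; decidable-stable)

-- Finite sums and counting

∑ : ℕ → (ℕ → ℕ) → ℕ
∑ zero    f = 0
∑ (suc n) f = f 0 + ∑ n (f ∘ suc)

∑-mono : ∀ n {f g} → (∀ i → i < n → f i ≤ g i) → ∑ n f ≤ ∑ n g
∑-mono zero    f≤g = z≤n
∑-mono (suc n) f≤g = +-mono-≤ (f≤g 0 z<s) (∑-mono n λ i i<n → f≤g (suc i) (s<s i<n))

∑-cong : ∀ n {f g} → (∀ i → i < n → f i ≡ g i) → ∑ n f ≡ ∑ n g
∑-cong n f≡g = ≤-antisym (∑-mono n λ i i<n → ≤-reflexive (f≡g i i<n))
                         (∑-mono n λ i i<n → ≤-reflexive (sym (f≡g i i<n)))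

∑-const : ∀ n c → ∑ n (λ _ → c) ≡ n * c
∑-const zero    c = refl
∑-const (suc n) c = cong (c +_) (∑-const n c)

∑-+ : ∀ n f g → ∑ n (λ i → f i + g i) ≡ ∑ n f + ∑ n g
∑-+ zero    f g = refl
∑-+ (suc n) f g = begin
  f 0 + g 0 + ∑ n (λ i → f (suc i) + g (suc i))        ≡⟨ cong (f 0 + g 0 +_) (∑-+ n (f ∘ suc) (g ∘ suc)) ⟩
  f 0 + g 0 + (∑ n (f ∘ suc) + ∑ n (g ∘ suc))          ≡⟨ +-assoc-middle (f 0) (g 0) _ _ ⟩
  f 0 + ∑ n (f ∘ suc) + (g 0 + ∑ n (g ∘ suc))          ∎
  where
  open ≡-Reasoning
  +-assoc-middle : ∀ a b c d → a + b + (c + d) ≡ a + c + (b + d)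
  +-assoc-middle = solve-∀

∑∑-+ : ∀ l m (f g : ℕ → ℕ → ℕ) →
       ∑ l (λ a → ∑ m λ b → f a b + g a b) ≡ ∑ l (λ a → ∑ m (f a)) + ∑ l (λ a → ∑ m (g a))
∑∑-+ l m f g = trans (∑-cong l λ a _ → ∑-+ m (f a) (g a)) (∑-+ l _ _)

∑-split : ∀ p q f → ∑ (p + q) f ≡ ∑ p f + ∑ q (λ i → f (p + i))
∑-split zero    q f = refl
∑-split (suc p) q f = trans (cong (f 0 +_) (∑-split p q (f ∘ suc))) (sym (+-assoc (f 0) _ _))

∑-positive : ∀ n f → 0 < ∑ n f → ∃[ i ] i < n × 0 < f i
∑-positive (suc n) f pos with f 0 in eq
... | suc _ = 0 , z<s , subst (0 <_) (sym eq) z<s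
... | zero  = let i , i<n , fi = ∑-positive n (f ∘ suc) pos in suc i , s<s i<n , fi

∑-≤1 : ∀ n {f} → (∀ i → i < n → f i ≤ 1) →
       (∀ i j → i < n → j < n → 0 < f i → 0 < f j → i ≡ j) → ∑ n f ≤ 1
∑-≤1 zero    f≤1 unique = z≤n
∑-≤1 (suc n) {f} f≤1 unique with f 0 in eq
... | zero = ∑-≤1 n (λ i i<n → f≤1 (suc i) (s<s i<n))
               (λ i j i<n j<n p q → suc-injective (unique (suc i) (suc j) (s<s i<n) (s<s j<n) p q))
... | suc x = begin
  suc x + ∑ n (f ∘ suc)  ≤⟨ +-monoʳ-≤ (suc x) (∑-mono n rest) ⟩
  suc x + ∑ n (λ _ → 0)  ≡⟨ cong (suc x +_) (trans (∑-const n 0) (*-zeroʳ n)) ⟩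
  suc x + 0              ≡⟨ +-identityʳ _ ⟩
  suc x                  ≡⟨ eq ⟨
  f 0                    ≤⟨ f≤1 0 z<s ⟩
  1                      ∎
  where
  open ≤-Reasoning
  rest : ∀ i → i < n → f (suc i) ≤ 0
  rest i i<n with f (suc i) in eq′
  ... | zero  = z≤n
  ... | suc _ with () ← unique 0 (suc i) z<s (s<s i<n) (subst (0 <_) (sym eq) z<s) (subst (0 <_) (sym eq′) z<s)

χ : Bool → ℕ
χ b = if b then 1 else 0

χ-≤1 : ∀ b → χ b ≤ 1
χ-≤1 true  = ≤-refl
χ-≤1 false = z≤n

0<χ⇒true : ∀ {b} → 0 < χ b → b ≡ true
0<χ⇒true {true} _ = refl

χ-complement : ∀ b → χ (not b) + χ b ≡ 1
χ-complement true  = refl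
χ-complement false = refl

∑∑-≤1 : ∀ m {f : ℕ → ℕ → Bool} →
        (∀ {a b c d} → a < m → b < m → c < m → d < m → f a b ≡ true → f c d ≡ true → a ≡ c × b ≡ d) →
        ∑ m (λ a → ∑ m λ b → χ (f a b)) ≤ 1
∑∑-≤1 m {f} unique = ∑-≤1 m
  (λ a a<m → ∑-≤1 m (λ b _ → χ-≤1 (f a b))
     λ b d b<m d<m p q → proj₂ (unique a<m b<m a<m d<m (0<χ⇒true p) (0<χ⇒true q)))
  λ a c a<m c<m p q →
    let b , b<m , p′ = ∑-positive m _ p
        d , d<m , q′ = ∑-positive m _ q
    in proj₁ (unique a<m b<m c<m d<m (0<χ⇒true p′) (0<χ⇒true q′))

-- Pigeonhole by induction on the number of colours: injectivity leaves at most one pair with the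
-- top colour `k`, and the remaining pairs use colours below `k`.
∑∑-injective-≤ : ∀ m k {f : ℕ → ℕ → Bool} (colour : ℕ → ℕ → ℕ) →
  (∀ {a b} → a < m → b < m → f a b ≡ true → colour a b < k) →
  (∀ {a b c d} → a < m → b < m → c < m → d < m → f a b ≡ true → f c d ≡ true →
     colour a b ≡ colour c d → a ≡ c × b ≡ d) →
  ∑ m (λ a → ∑ m λ b → χ (f a b)) ≤ k
∑∑-injective-≤ m zero {f} colour bound inj = begin
  ∑ m (λ a → ∑ m λ b → χ (f a b))  ≤⟨ ∑-mono m (λ a a<m → ∑-mono m λ b b<m → none a<m b<m) ⟩
  ∑ m (λ a → ∑ m λ b → 0)          ≡⟨ ∑-cong m (λ _ _ → trans (∑-const m 0) (*-zeroʳ m)) ⟩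
  ∑ m (λ a → 0)                    ≡⟨ trans (∑-const m 0) (*-zeroʳ m) ⟩
  0                                ∎
  where
  open ≤-Reasoning
  none : ∀ {a b} → a < m → b < m → χ (f a b) ≤ 0
  none {a} {b} a<m b<m with f a b in eq
  ... | false = z≤n
  ... | true with () ← bound a<m b<m eq
∑∑-injective-≤ m (suc k) {f} colour bound inj = begin
  ∑ m (λ a → ∑ m λ b → χ (f a b))
    ≡⟨ ∑-cong m (λ a _ → ∑-cong m λ b _ → split a b) ⟩
  ∑ m (λ a → ∑ m λ b → χ (top a b) + χ (rest a b))
    ≡⟨ ∑∑-+ m m _ _ ⟩
  ∑ m (λ a → ∑ m λ b → χ (top a b)) + ∑ m (λ a → ∑ m λ b → χ (rest a b))
    ≤⟨ +-mono-≤
         (∑∑-≤1 m λ {a} {b} {c} {d} a<m b<m c<m d<m p q →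
            let p₁ , p₂ = top⇒ a b p ; q₁ , q₂ = top⇒ c d q
            in inj a<m b<m c<m d<m p₁ q₁ (trans p₂ (sym q₂)))
         (∑∑-injective-≤ m k colour
            (λ {a} {b} a<m b<m p → let p₁ , p₂ = rest⇒ a b p
                                   in ≤∧≢⇒< (s≤s⁻¹ (bound a<m b<m p₁)) p₂)
            λ {a} {b} {c} {d} a<m b<m c<m d<m p q →
              inj a<m b<m c<m d<m (proj₁ (rest⇒ a b p)) (proj₁ (rest⇒ c d q))) ⟩
  suc k ∎
  where
  open ≤-Reasoning
  top rest : ℕ → ℕ → Bool
  top a b = f a b ∧ does (colour a b ≟ k)
  rest a b = f a b ∧ not (does (colour a b ≟ k))
  split : ∀ a b → χ (f a b) ≡ χ (top a b) + χ (rest a b)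
  split a b with f a b | does (colour a b ≟ k)
  ... | false | _     = refl
  ... | true  | true  = refl
  ... | true  | false = refl
  top⇒ : ∀ a b → top a b ≡ true → f a b ≡ true × colour a b ≡ k
  top⇒ a b p with true ← f a b with colour a b ≟ k
  ... | yes ≡k = refl , ≡k
  ... | no ≢k with () ← trans (sym (dec-false (colour a b ≟ k) ≢k)) p
  rest⇒ : ∀ a b → rest a b ≡ true → f a b ≡ true × colour a b ≢ k
  rest⇒ a b p with true ← f a b with colour a b ≟ k
  ... | no ≢k = refl , ≢k
  ... | yes ≡k with () ← trans (sym (cong not (dec-true (colour a b ≟ k) ≡k))) p

-- Arcs

-- Edge e joins e to e + 1 (mod m).  For a < b the cycle splits into the arc
-- avoiding the edge m − 1 (false) and the arc through it (true).
OnArc : Bool → ℕ → ℕ → ℕ → Set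
OnArc false a b e = a ≤ e × e < b
OnArc true  a b e = e < a ⊎ b ≤ e

onArc? : ∀ w a b e → Dec (OnArc w a b e)
onArc? false a b e = (a ≤? e) ×-dec (e <? b)
onArc? true  a b e = (e <? a) ⊎-dec (b ≤? e)

inside : ∀ w {a b e} → OnArc false a b e → does (onArc? w a b e) ≡ not w
inside false on = dec-true (onArc? false _ _ _) on
inside true (a≤e , e<b) = dec-false (onArc? true _ _ _) [ ≤⇒≯ a≤e , <⇒≱ e<b ]′

outside : ∀ w {a b e} → OnArc true a b e → does (onArc? w a b e) ≡ w
outside true on = dec-true (onArc? true _ _ _) on
outside false {a} {b} {e} (inj₁ e<a) = dec-false (onArc? false a b e) (<⇒≱ e<a ∘ proj₁)
outside false {a} {b} {e} (inj₂ b≤e) = dec-false (onArc? false a b e) (≤⇒≯ b≤e ∘ proj₂)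

-- Congestion

module Congestion (n′ : ℕ) (wraps : ℕ → ℕ → Bool) where

  n m : ℕ
  n = suc n′
  m = n + n

  -- The test `a <? b` lets `load` sum over all ordered pairs while counting each unordered pair
  -- once.
  covers : ℕ → ℕ → ℕ → Bool
  covers e a b = does (a <? b) ∧ does (onArc? (wraps a b) a b e)

  load : ℕ → ℕ
  load e = ∑ m λ a → ∑ m λ b → χ (covers e a b)

  load-+ : ∀ i j → load i + load j ≡ ∑ m λ a → ∑ m λ b → χ (covers i a b) + χ (covers j a b)
  load-+ i j = sym (∑∑-+ m m (λ a b → χ (covers i a b)) (λ a b → χ (covers j a b)))

  covers-inside : ∀ {e a b} → a < b → OnArc false a b e → covers e a b ≡ not (wraps a b)
  covers-inside {e} {a} {b} a<b on rewrite dec-true (a <? b) a<b = inside (wraps a b) on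

  covers-outside : ∀ {e a b} → a < b → OnArc true a b e → covers e a b ≡ wraps a b
  covers-outside {e} {a} {b} a<b on rewrite dec-true (a <? b) a<b = outside (wraps a b) on

  covers-none : ∀ e {a b} → ¬ a < b → covers e a b ≡ false
  covers-none e {a} {b} a≮b rewrite dec-false (a <? b) a≮b = refl

  covers⇒ : ∀ {e a b} → covers e a b ≡ true → a < b × OnArc (wraps a b) a b e
  covers⇒ {e} {a} {b} on with a <? b
  ... | no a≮b with () ← trans (sym (covers-none e a≮b)) on
  ... | yes a<b with onArc? (wraps a b) a b e
  ... | yes on-e = a<b , on-e
  ... | no _ with () ← trans (sym on) (cong (_∧ false) (dec-true (a <? b) a<b))

  -- The edges `i` and `j` lie on opposite arcs between `a` and `b`, so whichever arc `wraps`
  -- selects contains exactly one of them.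
  separated : ∀ {i j a b} → a < b → OnArc false a b i → OnArc true a b j →
              χ (covers i a b) + χ (covers j a b) ≡ 1
  separated {a = a} {b} a<b i∈ j∉
    rewrite covers-inside a<b i∈ | covers-outside a<b j∉ = χ-complement (wraps a b)

  -- Removing the edges `i` and `i + n` leaves the `n` vertices `p, …, p + n - 1` on one side and,
  -- on the other, `p` vertices before them and `q` after them. The separated pairs `a < b` number
  -- `p * n` with `a` before the block and `n * q` with `b` after it; each contributes 1.
  antipodal-load : ∀ i → i < n → n * n ≤ load i + load (i + n)
  antipodal-load i i<n = begin
    n * n                          ≡⟨ square {p} {q} p+q≡n ⟩
    p * n + n * q                  ≡⟨ cong₂ _+_ (∑-const p n) (∑-const n q) ⟨
    ∑ p (λ _ → n) + ∑ n (λ _ → q)  ≤⟨ +-mono-≤ (∑-mono p first-row) (∑-mono n λ a → second-row a) ⟩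
    ∑ p row + ∑ n (λ a → row (p + a))
      ≤⟨ m≤m+n _ _ ⟩
    ∑ p row + ∑ n (λ a → row (p + a)) + ∑ q (λ a → row (p + n + a))
      ≡⟨ cong (_+ ∑ q (λ a → row (p + n + a))) (∑-split p n row) ⟨
    ∑ (p + n) row + ∑ q (λ a → row (p + n + a))
      ≡⟨ ∑-split (p + n) q row ⟨
    ∑ (p + n + q) row              ≡⟨ cong (λ x → ∑ x row) m≡ ⟨
    ∑ m row                        ≡⟨ load-+ i (i + n) ⟨
    load i + load (i + n)          ∎
    where
    open ≤-Reasoning
    p q : ℕ
    p = suc i
    q = n ∸ suc i
    p+q≡n : p + q ≡ n
    p+q≡n = m+[n∸m]≡n i<n
    square : ∀ {p q n} → p + q ≡ n → n * n ≡ p * n + n * q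
    square {p} {q} refl = lemma p q
      where
      lemma : ∀ p q → (p + q) * (p + q) ≡ p * (p + q) + (p + q) * q
      lemma = solve-∀
    m≡ : m ≡ p + n + q
    m≡ = trans (cong (_+ n) (sym p+q≡n)) (lemma p q n)
      where
      lemma : ∀ p q n → p + q + n ≡ p + n + q
      lemma = solve-∀
    term : ℕ → ℕ → ℕ
    term a b = χ (covers i a b) + χ (covers (i + n) a b)
    row : ℕ → ℕ
    row a = ∑ m (term a)
    row-split : ∀ a → row a ≡ ∑ p (term a) + ∑ n (λ b → term a (p + b)) + ∑ q (λ b → term a (p + n + b))
    row-split a = trans (cong (λ x → ∑ x (term a)) m≡)
      (trans (∑-split (p + n) q (term a)) (cong (_+ ∑ q (λ b → term a (p + n + b))) (∑-split p n (term a))))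
    first-row : ∀ a → a < p → n ≤ row a
    first-row a a<p = begin
      n                               ≡⟨ trans (∑-const n 1) (*-identityʳ n) ⟨
      ∑ n (λ _ → 1)                   ≡⟨ ∑-cong n (λ b b<n → separated (≤-trans a<p (m≤m+n p b))
                                           (s≤s⁻¹ a<p , m≤m+n p b)
                                           (inj₂ (subst (_≤ i + n) (+-suc i b) (+-monoʳ-≤ i b<n)))) ⟨
      ∑ n (λ b → term a (p + b))      ≤⟨ m≤n+m _ (∑ p (term a)) ⟩
      ∑ p (term a) + ∑ n (λ b → term a (p + b)) ≤⟨ m≤m+n _ _ ⟩
      ∑ p (term a) + ∑ n (λ b → term a (p + b)) + ∑ q (λ b → term a (p + n + b)) ≡⟨ row-split a ⟨
      row a                           ∎
    second-row : ∀ a → a < n → q ≤ row (p + a)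
    second-row a a<n = begin
      q                               ≡⟨ trans (∑-const q 1) (*-identityʳ q) ⟨
      -- Here `i + n` is the edge between the endpoints and `i` the one outside, hence the commuted
      -- summands.
      ∑ q (λ _ → 1)                   ≡⟨ ∑-cong q (λ b b<q → trans (+-comm (χ (covers i (p + a) (p + n + b))) _)
                                           (separated (s≤s (≤-trans p+a≤i+n (m≤m+n (i + n) b)))
                                              (p+a≤i+n , m≤m+n (p + n) b)
                                              (inj₁ (m≤m+n p a)))) ⟨
      ∑ q (λ b → term (p + a) (p + n + b)) ≤⟨ m≤n+m _ _ ⟩
      ∑ p (term (p + a)) + ∑ n (λ b → term (p + a) (p + b)) + ∑ q (λ b → term (p + a) (p + n + b)) ≡⟨ row-split (p + a) ⟨
      row (p + a)                     ∎
      where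
      p+a≤i+n : p + a ≤ i + n
      p+a≤i+n = subst (_≤ i + n) (+-suc i a) (+-monoʳ-≤ i a<n)

  -- Arcs ending at vertex 0 contain exactly one of its two edges 0 and m − 1,
  -- all other arcs contain both or neither.
  load-parity : ∃[ y ] load 0 + load (n′ + n) ≡ suc (n′ + n′ + (y + y))
  load-parity = y , (begin
    load 0 + load (n′ + n)                                ≡⟨ load-+ 0 (n′ + n) ⟩
    ∑ m (term 0) + ∑ (n′ + n) (λ a → ∑ m (term (suc a)))  ≡⟨ cong₂ _+_ row₀ rows ⟩
    n′ + n + (y + y)                                      ≡⟨ cong (_+ (y + y)) (+-suc n′ n′) ⟩
    suc (n′ + n′ + (y + y))                               ∎)
    where
    open ≡-Reasoning
    term : ℕ → ℕ → ℕ
    term a b = χ (covers 0 a b) + χ (covers (n′ + n) a b)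
    y : ℕ
    y = ∑ (n′ + n) λ a → ∑ m λ b → χ (covers 0 (suc a) b)
    row₀ : ∑ m (term 0) ≡ n′ + n
    -- The summand at `b = 0` computes to 0, so only the `n′ + n` pairs {0, b} with `b > 0` remain.
    row₀ = trans (∑-cong (n′ + n) λ b b<m → separated z<s (z≤n , z<s) (inj₂ b<m))
                 (trans (∑-const (n′ + n) 1) (*-identityʳ _))
    same : ∀ a b → b < m → covers (n′ + n) (suc a) b ≡ covers 0 (suc a) b
    same a b b<m = case suc a <? b of λ where
      (yes a<b) → trans (covers-outside a<b (inj₂ (s≤s⁻¹ b<m))) (sym (covers-outside a<b (inj₁ z<s)))
      (no a≮b)  → trans (covers-none (n′ + n) a≮b) (sym (covers-none 0 a≮b))
    rows : ∑ (n′ + n) (λ a → ∑ m (term (suc a))) ≡ y + y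
    rows = trans
      (∑-cong (n′ + n) λ a _ → ∑-cong m λ b b<m → cong (λ x → χ (covers 0 (suc a) b) + χ x) (same a b b<m))
      (∑∑-+ (n′ + n) m (λ a b → χ (covers 0 (suc a) b)) (λ a b → χ (covers 0 (suc a) b)))

  -- The adjacent edges `0` and `n′ + n` suffice. If `k + k ≤ n * n`, comparing them with their
  -- opposites `n` and `n′` forces both loads to be `k`; their sum is then even, against
  -- `load-parity`.
  n²<2k : ∀ k → (∀ e → e < m → load e ≤ k) → n * n < k + k
  n²<2k k load≤k with n * n <? k + k
  ... | yes lt = lt
  ... | no ≮ = contradiction odd-sum (even≢odd k (n′ + y))
    where
    y : ℕ
    y = proj₁ load-parity
    k≤load : ∀ {x y} → y ≤ k → n * n ≤ x + y → k ≤ x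
    k≤load {x} {y} y≤k n²≤ = +-cancelʳ-≤ k k x (≤-trans (≮⇒≥ ≮) (≤-trans n²≤ (+-monoʳ-≤ x y≤k)))
    load₀ : load 0 ≡ k
    load₀ = ≤-antisym (load≤k 0 z<s) (k≤load (load≤k n (m<m+n n z<s)) (antipodal-load 0 z<s))
    load₁ : load (n′ + n) ≡ k
    load₁ = ≤-antisym (load≤k _ ≤-refl)
      (k≤load (load≤k n′ (m≤m+n n n)) (subst (n * n ≤_) (+-comm (load n′) _) (antipodal-load n′ ≤-refl)))
    double : ∀ a → 2 * a ≡ a + a
    double = solve-∀
    regroup : ∀ a b → a + a + (b + b) ≡ 2 * (a + b)
    regroup = solve-∀
    odd-sum : 2 * k ≡ suc (2 * (n′ + y))
    odd-sum = begin
      2 * k                    ≡⟨ double k ⟩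
      k + k                    ≡⟨ cong₂ _+_ load₀ load₁ ⟨
      load 0 + load (n′ + n)   ≡⟨ proj₂ load-parity ⟩
      suc (n′ + n′ + (y + y))  ≡⟨ cong suc (regroup n′ y) ⟩
      suc (2 * (n′ + y))       ∎
      where open ≡-Reasoning

-- Every path covers one of the two arcs

-- The first step out of `P`. The relation `R` is carried along so that the edge crossing a cut can
-- later be identified.
exit : ∀ {m} {R : Fin m → Fin m → Set} {P : Fin m → Set} → (∀ v → Dec (P v)) →
       ∀ {a b} xs → head xs ≡ just a → last xs ≡ just b → Linked R xs → P a → ¬ P b →
       ∃[ u ] ∃[ v ] Consec xs u v × R u v × P u × ¬ P v
exit P? (x ∷ []) refl refl _ Pa ¬Pb = contradiction Pa ¬Pb
exit P? (x ∷ y ∷ xs) refl end (r ∷ rs) Pa ¬Pb with P? y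
... | no ¬Py = x , y , here , r , Pa , ¬Py
... | yes Py = let u , v , c , rest = exit P? (y ∷ xs) refl end rs Py ¬Pb in u , v , there c , rest

consec? : ∀ {m} (xs : List (Fin m)) u v → Dec (Consec xs u v)
consec? []           u v = no λ ()
consec? (x ∷ [])     u v = no λ { (there ()) }
consec? (x ∷ y ∷ xs) u v with x ≟ᶠ u | y ≟ᶠ v | consec? (y ∷ xs) u v
... | yes refl | yes refl | _     = yes here
... | _        | _        | yes c = yes (there c)
... | no x≢u   | _        | no ¬c = no λ { here → x≢u refl ; (there c) → ¬c c }
... | yes _    | no y≢v   | no ¬c = no λ { here → y≢v refl ; (there c) → ¬c c }

next : ∀ {m} → Fin (suc m) → Fin (suc m)
next {m} e = suc (toℕ e) mod suc m

step⇒next : ∀ {m} {u v : Fin (suc m)} → CycleStep (suc m) u v → v ≡ next u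
step⇒next {m} {u} {v} s = toℕ-injective (sym (trans (toℕ-fromℕ< (m%n<n (suc (toℕ u)) (suc m))) (lemma s)))
  where
  lemma : CycleStep (suc m) u v → suc (toℕ u) % suc m ≡ toℕ v
  lemma (inj₁ eq)        = trans (m<n⇒m%n≡m (subst (_< suc m) (sym eq) (toℕ<n v))) eq
  lemma (inj₂ (eq , v0)) = trans (cong (_% suc m) eq) (trans (n%n≡0 (suc m)) (sym v0))

Uses : ∀ {m} → List (Fin (suc m)) → Fin (suc m) → Set
Uses xs e = UsesEdge xs e (next e)

uses? : ∀ {m} xs (e : Fin (suc m)) → Dec (Uses xs e)
uses? xs e = consec? xs e (next e) ⊎-dec consec? xs (next e) e

-- A forward step enters the interval from `lo + 1` to `hi` only along the edge `lo`: the step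
-- closing the cycle ends at 0, which is never in the interval.
step-boundary : ∀ {m} {lo hi u v : Fin m} → CycleStep m u v →
  ¬ (toℕ lo < toℕ u × toℕ u ≤ toℕ hi) → toℕ lo < toℕ v × toℕ v ≤ toℕ hi → u ≡ lo
step-boundary (inj₁ eq) out (lo<v , v≤hi) = toℕ-injective (≤-antisym
  (≮⇒≥ λ lo<u → out (lo<u , ≤-trans (≤-trans (n≤1+n _) (≤-reflexive eq)) v≤hi))
  (s≤s⁻¹ (≤-trans lo<v (≤-reflexive (sym eq)))))
step-boundary (inj₂ (_ , v0)) out (lo<v , _) with () ← subst (_ <_) v0 lo<v

boundary-step : ∀ {m} {lo hi u v : Fin m} → CycleStep m u v →
  toℕ lo < toℕ u × toℕ u ≤ toℕ hi → ¬ (toℕ lo < toℕ v × toℕ v ≤ toℕ hi) → u ≡ hi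
boundary-step {hi = hi} (inj₁ eq) (lo<u , u≤hi) out = toℕ-injective (≤-antisym u≤hi
  (≮⇒≥ λ u<hi → out (≤-trans lo<u (≤-trans (n≤1+n _) (≤-reflexive eq)) , subst (_≤ toℕ hi) eq u<hi)))
-- The closing step starts at `m - 1`, which lies in the interval only if it equals `hi`.
boundary-step {hi = hi} (inj₂ (eq , _)) (_ , u≤hi) out = toℕ-injective (≤-antisym u≤hi
  (s≤s⁻¹ (≤-trans (toℕ<n hi) (≤-reflexive (sym eq)))))

module _ {m : ℕ} {a b : Fin (suc m)} (P : CyclePath (suc m) a b) where

  Between : Fin (suc m) → Fin (suc m) → Fin (suc m) → Set
  Between lo hi v = toℕ lo < toℕ v × toℕ v ≤ toℕ hi

  between? : ∀ lo hi v → Dec (Between lo hi v)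
  between? lo hi v = (toℕ lo <? toℕ v) ×-dec (toℕ v ≤? toℕ hi)

  crossing : ∀ lo hi {u v} → UsesEdge (verts P) u v → CycleAdj (suc m) u v →
             Between lo hi u → ¬ Between lo hi v → Uses (verts P) lo ⊎ Uses (verts P) hi
  crossing lo hi c (inj₁ s) in-u out-v with refl ← boundary-step {lo = lo} {hi} s in-u out-v
    = inj₂ (subst (UsesEdge (verts P) hi) (step⇒next s) c)
  crossing lo hi c (inj₂ s) in-u out-v with refl ← step-boundary {lo = lo} {hi} s out-v in-u
    = inj₁ (subst (UsesEdge (verts P) lo) (step⇒next s) (swap c))

  -- Removing the edges lo and hi disconnects the vertices lo + 1, …, hi from the others.
  cut-out : ∀ lo hi → Between lo hi a → ¬ Between lo hi b → Uses (verts P) lo ⊎ Uses (verts P) hi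
  cut-out lo hi in-a out-b =
    let u , v , c , adj , in-u , out-v = exit (between? lo hi) (verts P) (starts P) (ends P) (adjacent P) in-a out-b
    in crossing lo hi (inj₁ c) adj in-u out-v

  cut-in : ∀ lo hi → ¬ Between lo hi a → Between lo hi b → Uses (verts P) lo ⊎ Uses (verts P) hi
  cut-in lo hi out-a in-b =
    let u , v , c , adj , out-u , ¬out-v = exit (¬? ∘ between? lo hi) (verts P) (starts P) (ends P) (adjacent P)
                                             out-a (λ out-b → out-b in-b)
    in crossing lo hi (inj₂ c) (swap adj) (decidable-stable (between? lo hi v) ¬out-v) out-u

  -- Two edges from opposite arcs cut `a` from `b`. If `j < a`, the interval from `j + 1` to `i`
  -- contains only `a`; if `b ≤ j`, the interval from `i + 1` to `j` contains only `b`.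
  one-of-two : ∀ i j → OnArc false (toℕ a) (toℕ b) (toℕ i) → OnArc true (toℕ a) (toℕ b) (toℕ j) →
               Uses (verts P) i ⊎ Uses (verts P) j
  one-of-two i j (a≤i , i<b) (inj₁ j<a) = swap (cut-out j i (j<a , a≤i) (<⇒≱ i<b ∘ proj₂))
  one-of-two i j (a≤i , i<b) (inj₂ b≤j) = cut-in i j (≤⇒≯ a≤i ∘ proj₁) (i<b , b≤j)

  -- If the path misses some edge `i` of the first arc, pairing `i` with each edge `j` of the second
  -- arc in `one-of-two` shows that every such `j` is used.
  covers-arc : ∃[ w ] ∀ e → OnArc w (toℕ a) (toℕ b) (toℕ e) → Uses (verts P) e
  covers-arc with all? (λ e → onArc? false (toℕ a) (toℕ b) (toℕ e) →-dec uses? (verts P) e)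
  ... | yes all = false , all
  ... | no ¬all with ¬∀⟶∃¬ (suc m) _ (λ e → onArc? false (toℕ a) (toℕ b) (toℕ e) →-dec uses? (verts P) e) ¬all
  ... | i , missed = true , λ j on-j → decidable-stable (uses? (verts P) j) λ unused-j →
    missed λ on-i → [ (λ u → u) , (λ u → contradiction u unused-j) ]′ (one-of-two i j on-i on-j)

-- Lower bound for packings

packing-bound : ∀ n′ k → Packable (suc n′ + suc n′) k → suc n′ * suc n′ < k + k
packing-bound n′ k (𝒫 , ω , proper) = n²<2k k load≤k
  where
  m : ℕ
  m = suc n′ + suc n′

  choice : ℕ → ℕ → Bool × ℕ
  choice a b with a <? b | b <? m
  ... | yes a<b | yes b<m = proj₁ (covers-arc (𝒫 A B p)) , toℕ (ω A B p)
    where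
    A B : Fin m
    A = fromℕ< (<-trans a<b b<m)
    B = fromℕ< b<m
    p : A <ᶠ B
    p = subst₂ _<_ (sym (toℕ-fromℕ< _)) (sym (toℕ-fromℕ< _)) a<b
  -- A harmless default: `load` only counts pairs with `a < b < m`.
  ... | _ | _ = false , 0

  -- The ordering proof is returned with the vertices because `𝒫` and `ω` take it as an argument.
  choice-spec : ∀ {a b} → a < b → b < m → ∃[ A ] ∃[ B ] Σ (A <ᶠ B) λ p → toℕ A ≡ a × toℕ B ≡ b ×
    (∀ e → OnArc (proj₁ (choice a b)) a b (toℕ e) → Uses (verts (𝒫 A B p)) e) ×
    proj₂ (choice a b) ≡ toℕ (ω A B p)
  choice-spec {a} {b} a<b b<m with a <? b | b <? m
  ... | no a≮b | _ = contradiction a<b a≮b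
  ... | yes _ | no b≮m = contradiction b<m b≮m
  ... | yes a<b′ | yes b<m′ = A , B , p , toℕ-fromℕ< _ , toℕ-fromℕ< _ ,
    (λ e on → proj₂ (covers-arc (𝒫 A B p)) e
       (subst₂ (λ x y → OnArc (proj₁ (covers-arc (𝒫 A B p))) x y (toℕ e))
         (sym (toℕ-fromℕ< _)) (sym (toℕ-fromℕ< _)) on)) , refl
    where
    A B : Fin m
    A = fromℕ< (<-trans a<b′ b<m′)
    B = fromℕ< b<m′
    p : A <ᶠ B
    p = subst₂ _<_ (sym (toℕ-fromℕ< _)) (sym (toℕ-fromℕ< _)) a<b′

  open Congestion n′ (λ a b → proj₁ (choice a b)) hiding (m)

  -- Pairs whose selected arcs contain `e` have paths sharing the edge from `E` to `next E`, so
  -- distinct pairs among them get distinct colours.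
  load≤k : ∀ e → e < m → load e ≤ k
  load≤k e e<m = ∑∑-injective-≤ m k (λ a b → proj₂ (choice a b)) bound injective
    where
    E : Fin m
    E = fromℕ< e<m
    bound : ∀ {a b} → a < m → b < m → covers e a b ≡ true → proj₂ (choice a b) < k
    bound _ b<m on with covers⇒ on
    ... | a<b , _ with choice-spec a<b b<m
    ... | A , B , p , _ , _ , _ , eq = subst (_< k) (sym eq) (toℕ<n (ω A B p))
    injective : ∀ {a b c d} → a < m → b < m → c < m → d < m → covers e a b ≡ true → covers e c d ≡ true →
                proj₂ (choice a b) ≡ proj₂ (choice c d) → a ≡ c × b ≡ d
    injective _ b<m _ d<m on on′ same with covers⇒ on | covers⇒ on′
    ... | a<b , on-ab | c<d , on-cd with choice-spec a<b b<m | choice-spec c<d d<m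
    ... | A , B , p , refl , refl , uses , eq | C′ , D , q , refl , refl , uses′ , eq′
      = Product.map (cong toℕ) (cong toℕ) (decidable-stable ((A ≟ᶠ C′) ×-dec (B ≟ᶠ D)) λ distinct →
          proper A B C′ D p q distinct
            (E , next E , uses E (subst (OnArc _ _ _) (sym (toℕ-fromℕ< e<m)) on-ab)
                        , uses′ E (subst (OnArc _ _ _) (sym (toℕ-fromℕ< e<m)) on-cd))
            (toℕ-injective (trans (sym eq) (trans same eq′))))

-- Realising arcs by paths

last-applyUpTo : ∀ {A : Set} (f : ℕ → A) d → last (applyUpTo f (suc d)) ≡ just (f d)
last-applyUpTo f zero    = refl
last-applyUpTo f (suc d) = last-applyUpTo (f ∘ suc) d

consec-applyUpTo : ∀ {m} (f : ℕ → Fin m) d {u v} → Consec (applyUpTo f (suc d)) u v →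
                   ∃[ i ] i < d × u ≡ f i × v ≡ f (suc i)
consec-applyUpTo f zero    (there ())
consec-applyUpTo f (suc d) here      = 0 , z<s , refl , refl
consec-applyUpTo f (suc d) (there c) =
  let i , i<d , eqs = consec-applyUpTo (f ∘ suc) d c in suc i , s<s i<d , eqs

EdgeOn : ∀ {m} → Bool → (a b u v : Fin m) → Set
EdgeOn {m} w a b u v = (CycleStep m u v × OnArc w (toℕ a) (toℕ b) (toℕ u))
                     ⊎ (CycleStep m v u × OnArc w (toℕ a) (toℕ b) (toℕ v))

edgeOn⇒adj : ∀ {m} w {a b u v : Fin m} → EdgeOn w a b u v → CycleAdj m u v
edgeOn⇒adj w (inj₁ (s , _)) = inj₁ s
edgeOn⇒adj w (inj₂ (s , _)) = inj₂ s

-- Tabulating a vertex sequence reduces adjacency and distinctness to statements about indices. The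
-- second component confines the path to one arc, which is what disjointness of colour classes
-- needs.
walk : ∀ {m} w {a b : Fin m} (f : ℕ → Fin m) d → f 0 ≡ a → f d ≡ b →
       (∀ i → i < d → EdgeOn w a b (f i) (f (suc i))) →
       (∀ {i j} → i < j → j ≤ d → f i ≢ f j) →
       Σ (CyclePath m a b) λ P → ∀ {u v} → UsesEdge (verts P) u v → EdgeOn w a b u v
walk w {a} {b} f d f0≡a fd≡b step inj = P , λ where
    (inj₁ c) → consec c
    (inj₂ c) → swap (consec c)
  where
  P : CyclePath _ a b
  P = record
    { verts    = applyUpTo f (suc d)
    ; starts   = cong just f0≡a
    ; ends     = trans (last-applyUpTo f d) (cong just fd≡b)
    ; adjacent = Linked.applyUpTo⁺₁ f (suc d) λ i<d → edgeOn⇒adj w (step _ (s≤s⁻¹ i<d))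
    ; distinct = Unique.applyUpTo⁺₁ f (suc d) λ i<j j<d → inj i<j (s≤s⁻¹ j<d)
    }
  consec : ∀ {u v} → Consec (verts P) u v → EdgeOn w a b u v
  consec c with i , i<d , refl , refl ← consec-applyUpTo f d c = step i i<d

module _ {m′ : ℕ} where

  private
    m : ℕ
    m = suc m′

  toℕ-mod : ∀ x → toℕ (x mod m) ≡ x % m
  toℕ-mod x = toℕ-fromℕ< (m%n<n x m)

  mod-small : ∀ {x} → x < m → toℕ (x mod m) ≡ x
  mod-small {x} x<m = trans (toℕ-mod x) (m<n⇒m%n≡m x<m)

  mod-wrapped : ∀ {x} → x < m → toℕ ((m + x) mod m) ≡ x
  mod-wrapped {x} x<m = trans (toℕ-mod (m + x))
    (trans (cong (_% m) (+-comm m x)) (trans ([m+n]%n≡m%n x m) (m<n⇒m%n≡m x<m)))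

  suc-% : ∀ x → suc x % m ≡ suc (x % m) % m
  suc-% x = trans (cong (λ y → suc y % m) (m≡m%n+[m/n]*n x m)) ([m+kn]%n≡m%n (suc (x % m)) (x / m) m)

  mod-step : ∀ x → CycleStep m (x mod m) (suc x mod m)
  mod-step x with m≤n⇒m<n∨m≡n (m%n<n x m)
  ... | inj₁ <m = inj₁ (trans (cong suc (toℕ-mod x))
                          (sym (trans (toℕ-mod (suc x)) (trans (suc-% x) (m<n⇒m%n≡m <m)))))
  ... | inj₂ ≡m = inj₂ ( trans (cong suc (toℕ-mod x)) ≡m
                       , trans (toℕ-mod (suc x)) (trans (suc-% x) (trans (cong (_% m) ≡m) (n%n≡0 m))) )

  -- The direct arc ascends from `a` to `b`. The wrapping arc descends from `m + a`, a lift of `a`,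
  -- to `b`, and is reduced modulo `m`, so it passes through 0.
  arcPath : ∀ w (a b : Fin m) → a <ᶠ b →
            Σ (CyclePath m a b) λ P → ∀ {u v} → UsesEdge (verts P) u v → EdgeOn w a b u v
  arcPath false a b a<b = walk false f d
      (toℕ-injective (trans (f-toℕ z≤n) (+-identityʳ _)))
      (toℕ-injective (trans (f-toℕ ≤-refl) a+d≡b))
      step inj
    where
    d : ℕ
    d = toℕ b ∸ toℕ a
    a+d≡b : toℕ a + d ≡ toℕ b
    a+d≡b = m+[n∸m]≡n (<⇒≤ a<b)
    f : ℕ → Fin m
    f i = (toℕ a + i) mod m
    f-toℕ : ∀ {i} → i ≤ d → toℕ (f i) ≡ toℕ a + i
    f-toℕ {i} i≤d = mod-small (≤-trans (s≤s (subst (toℕ a + i ≤_) a+d≡b (+-monoʳ-≤ (toℕ a) i≤d))) (toℕ<n b))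
    step : ∀ i → i < d → EdgeOn false a b (f i) (f (suc i))
    step i i<d = inj₁
      ( subst (λ x → CycleStep m (f i) (x mod m)) (sym (+-suc (toℕ a) i)) (mod-step (toℕ a + i))
      , subst (OnArc false (toℕ a) (toℕ b)) (sym (f-toℕ (<⇒≤ i<d)))
          (m≤m+n (toℕ a) i , subst (toℕ a + i <_) a+d≡b (+-monoʳ-< (toℕ a) i<d)) )
    inj : ∀ {i j} → i < j → j ≤ d → f i ≢ f j
    inj {i} {j} i<j j≤d eq = <⇒≢ i<j (+-cancelˡ-≡ (toℕ a) i j
      (trans (sym (f-toℕ (≤-trans (<⇒≤ i<j) j≤d))) (trans (cong toℕ eq) (f-toℕ j≤d))))
  arcPath true a b a<b = walk true f d
      (toℕ-injective (mod-wrapped (toℕ<n a)))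
      (toℕ-injective (trans (cong (λ x → toℕ (x mod m)) (m∸[m∸n]≡n b≤N)) (mod-small (toℕ<n b))))
      step inj
    where
    N d : ℕ
    N = m + toℕ a
    d = N ∸ toℕ b
    b≤N : toℕ b ≤ N
    b≤N = ≤-trans (<⇒≤ (toℕ<n b)) (m≤m+n m (toℕ a))
    f : ℕ → Fin m
    f i = (N ∸ i) mod m
    b≤ : ∀ {i} → i ≤ d → toℕ b ≤ N ∸ i
    b≤ {i} i≤d = subst (_≤ N ∸ i) (m∸[m∸n]≡n b≤N) (∸-monoʳ-≤ N i≤d)
    -- The lift `x` reduces either to itself, at least `b`, or to `x - m`, at most `a`. Since
    -- `a < b` these ranges are disjoint, which yields both injectivity and membership in the arc.
    position : ∀ {x} → toℕ b ≤ x → x ≤ N →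
               (toℕ b ≤ toℕ (x mod m) × toℕ (x mod m) ≡ x) ⊎ (toℕ (x mod m) ≤ toℕ a × m + toℕ (x mod m) ≡ x)
    position {x} b≤x x≤N with x <? m
    ... | yes x<m = inj₁ (subst (toℕ b ≤_) (sym (mod-small x<m)) b≤x , mod-small x<m)
    ... | no x≮m with y , refl ← m≤n⇒∃[o]m+o≡n (≮⇒≥ x≮m)
      = inj₂ (subst (_≤ toℕ a) (sym y≡) y≤a , cong (m +_) y≡)
      where
      y≤a : y ≤ toℕ a
      y≤a = +-cancelˡ-≤ m y (toℕ a) x≤N
      y≡ : toℕ ((m + y) mod m) ≡ y
      y≡ = mod-wrapped (≤-trans (s≤s y≤a) (toℕ<n a))
    step : ∀ i → i < d → EdgeOn true a b (f i) (f (suc i))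
    -- The walk descends, so its edge is labelled by the later vertex `f (suc i)`.
    step i i<d = inj₂ (subst (λ x → CycleStep m (f (suc i)) (x mod m)) suc-position (mod-step (N ∸ suc i)) , on-arc)
      where
      suc-position : suc (N ∸ suc i) ≡ N ∸ i
      suc-position = sym (+-∸-assoc 1 (≤-trans i<d (m∸n≤m N (toℕ b))))
      on-arc : OnArc true (toℕ a) (toℕ b) (toℕ (f (suc i)))
      on-arc with position (b≤ i<d) (m∸n≤m N (suc i))
      ... | inj₁ (b≤x , _)  = inj₂ b≤x
      ... | inj₂ (_ , m+x≡) = inj₁ (+-cancelˡ-< m _ _
              (subst (_≤ N) (trans (sym suc-position) (cong suc (sym m+x≡))) (m∸n≤m N i)))
    inj : ∀ {i j} → i < j → j ≤ d → f i ≢ f j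
    inj {i} {j} i<j j≤d eq = no-repeat
      where
      i≤N = ≤-trans (<⇒≤ i<j) (≤-trans j≤d (m∸n≤m N (toℕ b)))
      j≤N = ≤-trans j≤d (m∸n≤m N (toℕ b))
      no-repeat : ⊥
      no-repeat with position (b≤ (≤-trans (<⇒≤ i<j) j≤d)) (m∸n≤m N i) | position (b≤ j≤d) (m∸n≤m N j)
      ... | inj₁ (_ , p) | inj₁ (_ , q) = <⇒≢ i<j (∸-cancelˡ-≡ i≤N j≤N (trans (sym p) (trans (cong toℕ eq) q)))
      ... | inj₂ (_ , p) | inj₂ (_ , q) = <⇒≢ i<j (∸-cancelˡ-≡ i≤N j≤N
                                            (trans (sym p) (trans (cong (λ x → m + toℕ x) eq) q)))
      ... | inj₁ (b≤x , _) | inj₂ (x≤a , _) = <⇒≱ a<b (≤-trans b≤x (subst (λ x → toℕ x ≤ toℕ a) (sym eq) x≤a))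
      ... | inj₂ (x≤a , _) | inj₁ (b≤x , _) = <⇒≱ a<b (≤-trans b≤x (subst (λ x → toℕ x ≤ toℕ a) eq x≤a))

-- With more than two vertices no pair is joined by forward steps both ways, so a shared pair of
-- neighbours determines one edge label. For `m = 2` the labels 0 and 1 would denote the same edge.
common-edge : ∀ {m} → 2 < m → ∀ w w′ {a b c d u v : Fin m} → EdgeOn w a b u v → EdgeOn w′ c d u v →
              ∃[ e ] OnArc w (toℕ a) (toℕ b) e × OnArc w′ (toℕ c) (toℕ d) e
common-edge {m} 2<m _ _ {u = u} {v} = λ where
    (inj₁ (_ , on)) (inj₁ (_ , on′)) → toℕ u , on , on′
    (inj₂ (_ , on)) (inj₂ (_ , on′)) → toℕ v , on , on′
    (inj₁ (s , _))  (inj₂ (s′ , _))  → contradiction s′ (asymmetric s)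
    (inj₂ (s , _))  (inj₁ (s′ , _))  → contradiction s′ (asymmetric s)
  where
  asymmetric : ∀ {u v : Fin m} → CycleStep m u v → ¬ CycleStep m v u
  asymmetric (inj₁ p) (inj₁ q) = <⇒≢ (≤-trans (≤-reflexive p) (≤-trans (n≤1+n _) (≤-reflexive q))) refl
  asymmetric (inj₁ p) (inj₂ (q , r)) = <⇒≢ 2<m (trans (cong (2 +_) (sym r)) (trans (cong suc p) q))
  asymmetric (inj₂ (p , q)) (inj₁ r) = <⇒≢ 2<m (trans (cong (2 +_) (sym q)) (trans (cong suc r) p))
  asymmetric (inj₂ (p , q)) (inj₂ (r , s)) = <⇒≢ (≤-trans (n≤1+n _) 2<m) (trans (cong suc (sym s)) p)

-- The colouring

C2-suc : ∀ j → suc j C 2 ≡ j C 2 + j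
C2-suc j = trans (sym (nCk+nC[k+1]≡[n+1]C[k+1] j 1)) (trans (cong (_+ j C 2) (nC1≡n j)) (+-comm j _))

C2-mono : ∀ {j k} → j ≤ k → j C 2 ≤ k C 2
C2-mono {j} j≤k with d , refl ← m≤n⇒∃[o]m+o≡n j≤k = go d
  where
  go : ∀ d → j C 2 ≤ (j + d) C 2
  go zero    = ≤-reflexive (cong (_C 2) (sym (+-identityʳ j)))
  go (suc d) = ≤-trans (go d) (≤-trans (m≤m+n _ (j + d))
    (≤-reflexive (trans (sym (C2-suc (j + d))) (cong (_C 2) (sym (+-suc j d))))))

double-C2 : ∀ n → 2 * (n C 2) + n ≡ n * n
double-C2 zero    = refl
double-C2 (suc n) = begin
  2 * (suc n C 2) + suc n      ≡⟨ cong (λ x → 2 * x + suc n) (C2-suc n) ⟩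
  2 * (n C 2 + n) + suc n      ≡⟨ regroup (n C 2) n ⟩
  2 * (n C 2) + n + (2 * n + 1) ≡⟨ cong (_+ (2 * n + 1)) (double-C2 n) ⟩
  n * n + (2 * n + 1)          ≡⟨ square n ⟩
  suc n * suc n                ∎
  where
  open ≡-Reasoning
  regroup : ∀ c n → 2 * (c + n) + suc n ≡ 2 * c + n + (2 * n + 1)
  regroup = solve-∀
  square : ∀ n → n * n + (2 * n + 1) ≡ suc n * suc n
  square = solve-∀

-- Quad i j: the arcs between the points i, j, i + n, j + n; when i = 0 and j is odd, the
-- antipodal arc from j + n through 0 to j replaces the two arcs meeting at 0.
-- Helix w: the arcs 0 … 2w − 1, 2w … 2w + n and 2w + 1 + n … 2n.
data Colour : Set where
  quad  : (i j : ℕ) → Colour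
  helix : (w : ℕ) → Colour

Valid : ℕ → Colour → Set
Valid n (quad i j) = i < j × j < n
Valid n (helix w)  = w ≤ n / 2

-- The combinatorial number system: the pairs with larger element `j` fill the block of length `j`
-- starting at `j C 2`. The helix classes follow from `n C 2` on.
code : ℕ → Colour → ℕ
code n (quad i j) = j C 2 + i
code n (helix w)  = n C 2 + w

quad-code-< : ∀ {i j k} → i < j → j < k → j C 2 + i < k C 2
quad-code-< {i} {j} i<j j<k =
  ≤-trans (+-monoʳ-< (j C 2) i<j) (≤-trans (≤-reflexive (sym (C2-suc j))) (C2-mono j<k))

code-< : ∀ n c → Valid n c → code n c < n C 2 + n / 2 + 1
code-< n (quad i j) (i<j , j<n) = ≤-trans (quad-code-< i<j j<n) (≤-trans (m≤m+n _ (n / 2)) (m≤m+n _ 1))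
code-< n (helix w)  w≤n/2 = ≤-trans (s≤s (+-monoʳ-≤ (n C 2) w≤n/2)) (≤-reflexive (+-comm 1 _))

code-injective : ∀ n c c′ → Valid n c → Valid n c′ → code n c ≡ code n c′ → c ≡ c′
code-injective n (quad i j) (quad k l) (i<j , j<n) (k<l , l<n) eq with <-cmp j l
... | tri< j<l _ _  = contradiction eq (<⇒≢ (≤-trans (quad-code-< i<j j<l) (m≤m+n _ k)))
... | tri≈ _ refl _ = cong (λ x → quad x j) (+-cancelˡ-≡ (j C 2) i k eq)
... | tri> _ _ l<j  = contradiction (sym eq) (<⇒≢ (≤-trans (quad-code-< k<l l<j) (m≤m+n _ i)))
code-injective n (quad i j) (helix w) (i<j , j<n) _ eq = contradiction eq (<⇒≢ (≤-trans (quad-code-< i<j j<n) (m≤m+n _ w)))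
code-injective n (helix w) (quad i j) _ (i<j , j<n) eq = contradiction (sym eq) (<⇒≢ (≤-trans (quad-code-< i<j j<n) (m≤m+n _ w)))
code-injective n (helix w) (helix x) _ _ eq = cong helix (+-cancelˡ-≡ (n C 2) w x eq)

odd : ℕ → Bool
odd zero    = false
odd (suc n) = not (odd n)

halve : ∀ n → (odd n ≡ false × ∃[ w ] n ≡ w + w) ⊎ (odd n ≡ true × ∃[ w ] n ≡ suc (w + w))
halve zero = inj₁ (refl , 0 , refl)
halve (suc n) with halve n
... | inj₁ (eq , w , refl) = inj₂ (cong not eq , w , refl)
... | inj₂ (eq , w , refl) = inj₁ (cong not eq , suc w , cong suc (sym (+-suc w w)))

-- Marks the classes that exchange their two arcs at 0 for an antipodal arc.
special : ℕ → ℕ → Bool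
special zero    j = odd j
special (suc _) j = false

-- The first four kinds are the arcs of the quad of `i` and `j`. The arcs given up by the quad of 0
-- and `2w + 1` are `from-zero w` and `to-zero w`; parity is built into the indices where a helix
-- number is needed.
data Kind (n : ℕ) : ℕ → ℕ → Set where
  low      : ∀ {i j} → i < j → j < n → special i j ≡ false → Kind n i j
  middle   : ∀ {i j} → i < j → j < n → Kind n j (i + n)
  high     : ∀ {i j} → i < j → j < n → Kind n (i + n) (j + n)
  around   : ∀ {i j} → i < j → j < n → special i j ≡ false → Kind n i (j + n)
  odd-antipodal  : ∀ {j} → j < n → odd j ≡ true → Kind n j (j + n)
  even-antipodal : ∀ w → w + w < n → Kind n (w + w) (w + w + n)
  from-zero      : ∀ w → suc (w + w) < n → Kind n 0 (suc (w + w))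
  to-zero        : ∀ w → suc (w + w) < n → Kind n 0 (suc (w + w) + n)

wrapping : ∀ {n a b} → Kind n a b → Bool
wrapping (around _ _ _)      = true
wrapping (odd-antipodal _ _) = true
wrapping (to-zero _ _)       = true
wrapping _                   = false

colour : ∀ {n a b} → Kind n a b → Colour
colour (low {i} {j} _ _ _)        = quad i j
colour (middle {i} {j} _ _)       = quad i j
colour (high {i} {j} _ _)         = quad i j
colour (around {i} {j} _ _ _)     = quad i j
colour (odd-antipodal {j} _ _)    = quad 0 j
colour (even-antipodal w _)       = helix w
-- This arc ends at `2w + 1`, one edge before the antipodal arc of `helix (suc w)` starts.
colour (from-zero w _)            = helix (suc w)
colour (to-zero w _)              = helix w

double≤⇒≤half : ∀ {w n} → w + w ≤ n → w ≤ n / 2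
double≤⇒≤half {w} {n} w+w≤n = subst (_≤ n / 2) (trans (cong (_/ 2) (w+w≡w*2 w)) (m*n/n≡m w 2)) (/-monoˡ-≤ 2 w+w≤n)
  where
  w+w≡w*2 : ∀ w → w + w ≡ w * 2
  w+w≡w*2 = solve-∀

colour-valid : ∀ {n a b} (κ : Kind n a b) → Valid n (colour κ)
colour-valid (low i<j j<n _)    = i<j , j<n
colour-valid (middle i<j j<n)   = i<j , j<n
colour-valid (high i<j j<n)     = i<j , j<n
colour-valid (around i<j j<n _) = i<j , j<n
-- Oddness excludes `j = 0`, giving the required `0 < j`.
colour-valid (odd-antipodal {suc _} j<n _) = z<s , j<n
colour-valid (even-antipodal w <n) = double≤⇒≤half (<⇒≤ <n)
colour-valid {n} (from-zero w <n)  = double≤⇒≤half (subst (_≤ n) (cong suc (sym (+-suc w w))) <n)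
colour-valid (to-zero w <n)        = double≤⇒≤half (≤-trans (n≤1+n _) (<⇒≤ <n))

m≤n⇒∃[o]o+m≡n : ∀ {m n} → m ≤ n → ∃[ o ] o + m ≡ n
m≤n⇒∃[o]o+m≡n {m} {n} m≤n = n ∸ m , m∸n+n≡m m≤n

-- The halves containing `a` and `b` decide first. If only `b = j + n` is in the upper half,
-- comparing `a` with `j` separates `middle`, antipodal and `around`; a true `special` forces
-- `a = 0` and diverts the pair to a helix.
classify : ∀ n {a b} → a < b → b < n + n → Kind n a b
classify n {a} {b} a<b b<2n with b <? n
classify n {a} {b} a<b b<2n | yes b<n with special a b in eq
... | false = low a<b b<n eq
classify n {zero} {b} a<b b<2n | yes b<n | true with halve b
... | inj₁ (even , _) with () ← trans (sym even) eq
... | inj₂ (_ , w , refl) = from-zero w b<n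
classify n {a} {b} a<b b<2n | no b≮n with j , refl ← m≤n⇒∃[o]o+m≡n (≮⇒≥ b≮n) with a <? n
... | no a≮n with i , refl ← m≤n⇒∃[o]o+m≡n (≮⇒≥ a≮n)
  = high (+-cancelʳ-< n i j a<b) (+-cancelʳ-< n j n b<2n)
... | yes a<n with <-cmp a j
... | tri> _ _ j<a = middle j<a a<n
... | tri≈ _ refl _ with halve j
...   | inj₁ (_ , w , refl) = even-antipodal w a<n
...   | inj₂ (isOdd , _)    = odd-antipodal a<n isOdd
classify n {a} a<b b<2n | no b≮n | yes a<n | tri< a<j _ _ with special a j in eq
... | false = around a<j (+-cancelʳ-< n j n b<2n) eq
classify n {zero} a<b b<2n | no b≮n | yes a<n | tri< a<j _ _ | true with halve j
... | inj₁ (even , _) with () ← trans (sym even) eq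
... | inj₂ (_ , w , refl) = to-zero w (+-cancelʳ-< n _ n b<2n)

if-yes : ∀ {A P : Set} (P? : Dec P) {x y : A} → P → (if does P? then x else y) ≡ x
if-yes P? p rewrite dec-true P? p = refl

if-no : ∀ {A P : Set} (P? : Dec P) {x y : A} → ¬ P → (if does P? then x else y) ≡ y
if-no P? ¬p rewrite dec-false P? ¬p = refl

-- Disjointness within a colour class is expressed by recovering an arc's endpoints from its
-- colour and any one of its edges.
owner : ℕ → Colour → ℕ → ℕ × ℕ
owner n (quad i j) e =
  if does (e <? i)     then (if special i j then (j , j + n) else (i , j + n)) else
  if does (e <? j)     then (if special i j then (j , j + n) else (i , j)) else
  if does (e <? i + n) then (j , i + n) else
  if does (e <? j + n) then (i + n , j + n) else
                            (if special i j then (j , j + n) else (i , j + n))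
-- The gap edges `2w - 1` and `2w + n` also receive a value here, about which `owner-correct` claims
-- nothing.
owner n (helix w) e =
  if does (e <? w + w)     then (0 , w + w ∸ 1) else
  if does (e <? w + w + n) then (w + w , w + w + n) else
                                (0 , suc (w + w) + n)

owner-correct : ∀ {n a b} (κ : Kind n a b) e → OnArc (wrapping κ) a b e → owner n (colour κ) e ≡ (a , b)
owner-correct {n} (low {i} {j} i<j j<n sp) e (i≤e , e<j) rewrite sp =
  trans (if-no (e <? i) (≤⇒≯ i≤e)) (if-yes (e <? j) e<j)
owner-correct {n} (middle {i} {j} i<j j<n) e (j≤e , e<i+n) =
  trans (if-no (e <? i) (≤⇒≯ (≤-trans (<⇒≤ i<j) j≤e)))
  (trans (if-no (e <? j) (≤⇒≯ j≤e)) (if-yes (e <? i + n) e<i+n))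
owner-correct {n} (high {i} {j} i<j j<n) e (i+n≤e , e<j+n) =
  trans (if-no (e <? i) (≤⇒≯ (≤-trans (m≤m+n i n) i+n≤e)))
  (trans (if-no (e <? j) (≤⇒≯ (≤-trans (<⇒≤ j<n) (≤-trans (m≤n+m n i) i+n≤e))))
  (trans (if-no (e <? i + n) (≤⇒≯ i+n≤e)) (if-yes (e <? j + n) e<j+n)))
owner-correct {n} (around {i} {j} i<j j<n sp) e (inj₁ e<i) rewrite sp = if-yes (e <? i) e<i
owner-correct {n} (around {i} {j} i<j j<n sp) e (inj₂ j+n≤e) rewrite sp =
  trans (if-no (e <? i) (≤⇒≯ (≤-trans (<⇒≤ i<j) j≤e)))
  (trans (if-no (e <? j) (≤⇒≯ j≤e))
  (trans (if-no (e <? i + n) (≤⇒≯ (≤-trans (+-monoˡ-≤ n (<⇒≤ i<j)) j+n≤e)))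
         (if-no (e <? j + n) (≤⇒≯ j+n≤e))))
  where
  j≤e : j ≤ e
  j≤e = ≤-trans (m≤m+n j n) j+n≤e
-- With `i = 0` the guard `e <? i` computes to false, so the test against `j` comes first.
owner-correct {n} (odd-antipodal {j} j<n isOdd) e (inj₁ e<j) rewrite isOdd = if-yes (e <? j) e<j
owner-correct {n} (odd-antipodal {j} j<n isOdd) e (inj₂ j+n≤e) rewrite isOdd =
  trans (if-no (e <? j) (≤⇒≯ (≤-trans (m≤m+n j n) j+n≤e)))
  (trans (if-no (e <? n) (≤⇒≯ (≤-trans (m≤n+m n j) j+n≤e)))
         (if-no (e <? j + n) (≤⇒≯ j+n≤e)))
owner-correct {n} (even-antipodal w _) e (≤e , e<) =
  trans (if-no (e <? w + w) (≤⇒≯ ≤e)) (if-yes (e <? w + w + n) e<)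
owner-correct {n} (from-zero w _) e (_ , e<) =
  trans (if-yes (e <? suc w + suc w) (≤-trans e< (≤-trans (n≤1+n _) (≤-reflexive (cong suc (sym (+-suc w w)))))))
        (cong (0 ,_) (+-suc w w))
owner-correct {n} (to-zero w _) e (inj₂ ≤e) =
  trans (if-no (e <? w + w) (≤⇒≯ (≤-trans (m≤m+n (w + w) n) (<⇒≤ ≤e))))
        (if-no (e <? w + w + n) (≤⇒≯ (<⇒≤ ≤e)))

-- The packing and the value of Φ

packable : ∀ n′ → Packable (suc n′ + suc n′) (suc n′ C 2 + suc n′ / 2 + 1)
packable n′ = 𝒫 , ω , proper
  where
  n m : ℕ
  n = suc n′
  m = n + n
  kind : (a b : Fin m) → a <ᶠ b → Kind n (toℕ a) (toℕ b)
  kind a b a<b = classify n a<b (toℕ<n b)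
  𝒫 : PathSystem m
  𝒫 a b a<b = proj₁ (arcPath (wrapping (kind a b a<b)) a b a<b)
  ω : (a b : Fin m) → a <ᶠ b → Fin (n C 2 + n / 2 + 1)
  ω a b a<b = fromℕ< (code-< n (colour (kind a b a<b)) (colour-valid (kind a b a<b)))
  proper : IsGlobalPacking (n C 2 + n / 2 + 1) 𝒫 ω
  proper a b c d p q distinct (u , v , uses , uses′) same with m≤n⇒m<n∨m≡n (s≤s (z≤n {n′}))
  -- For `n = 1` there is only one pair of vertices; this case falls outside `common-edge`.
  ... | inj₂ refl = distinct (only a b c d p q)
    where
    only : (a b c d : Fin 2) → a <ᶠ b → c <ᶠ d → a ≡ c × b ≡ d
    only zero (suc zero) zero (suc zero) _ _ = refl , refl
    only (suc zero) (suc zero) _ _ (s≤s ()) _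
    only _ _ (suc zero) (suc zero) _ (s≤s ())
  ... | inj₁ 1<n =
    let κ = kind a b p
        κ′ = kind c d q
        e , on , on′ = common-edge (≤-trans (s≤s 1<n) (m<n+m n z<s)) (wrapping κ) (wrapping κ′)
                         (proj₂ (arcPath (wrapping κ) a b p) uses) (proj₂ (arcPath (wrapping κ′) c d q) uses′)
        same-colour = code-injective n (colour κ) (colour κ′) (colour-valid κ) (colour-valid κ′)
                        (fromℕ<-injective _ _ _ _ same)
        -- Both pairs are the owner of the shared edge `e` in their common colour class.
        same-pair = trans (sym (owner-correct κ e on))
                      (trans (cong (λ x → owner n x e) same-colour) (owner-correct κ′ e on′))
    in distinct (Product.map toℕ-injective toℕ-injective (,-injective same-pair))

theorem1 : (n : ℕ) → 1 ≤ n →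
    Φ-Cycle-is (2 * n) ((n C 2) + (n / 2) + 1)
theorem1 n@(suc n′) _ =
  subst (λ m → Φ-Cycle-is m (n C 2 + n / 2 + 1)) (cong (n +_) (sym (+-identityʳ n)))
    -- Twice the sum of `n C 2` and `n / 2` is at most `n * n`, hence less than `2 * k`. Halving the
    -- strict inequality produces the final `+ 1`.
    (packable n′ , λ k packing → subst (_≤ k) (+-comm 1 _) (*-cancelˡ-< 2 _ k (begin-strict
      2 * (n C 2 + n / 2)      ≡⟨ *-distribˡ-+ 2 (n C 2) (n / 2) ⟩
      2 * (n C 2) + 2 * (n / 2) ≡⟨ cong (2 * (n C 2) +_) (*-comm 2 (n / 2)) ⟩
      2 * (n C 2) + n / 2 * 2  ≤⟨ +-monoʳ-≤ (2 * (n C 2)) (m/n*n≤m n 2) ⟩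
      2 * (n C 2) + n          ≡⟨ double-C2 n ⟩
      n * n                    <⟨ packing-bound n′ k packing ⟩
      k + k                    ≡⟨ cong (k +_) (+-identityʳ k) ⟨
      2 * k                    ∎)))
  where open ≤-Reasoning
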